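{- Let $\mathcal{S}$ be an instance of the hereditary $3$-set packing problem, let $A\subseteq\mathcal{S}$ be a feasible solution such that there is no local improvement of $A$ of size at most $10$, and let $B\subseteq\mathcal{S}$ be an optimum solution. Then $w(B)\le\frac{4}{3}\cdot w(A)$.
   Context: An instance of the hereditary $3$-set packing problem is a finite family $\mathcal{S}$ of nonempty sets, each of cardinality at most $3$, that is hereditary: for every $s\in\mathcal{S}$, every nonempty subset of $s$ belongs to $\mathcal{S}$. Each $s\in\mathcal{S}$ has weight $w(s)=|s|-1$, and for a subfamily $X$, $w(X)=\sum_{s\in X}w(s)$. A feasible solution is a subfamily of pairwise disjoint sets; an optimum solution is a feasible solution of maximum weight. For set families $U,W$, the neighborhood is $N(U,W)=\{x\in W:\exists u\in U: u\cap x\ne\emptyset\}$. Given a feasible solution $A$, a subfamily $X\subseteq\mathcal{S}$ of pairwise disjoint sets is a local improvement of $A$ of size $|X|$ if either $w(X)>w(N(X,A))$, or $w(X)=w(N(X,A))$ and $X$ contains more sets of weight $2$ than $N(X,A)$ does. -}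

module Defs where

open import Data.Nat using (ℕ; _+_; _∸_; _≤_; _<_; _>_)
open import Data.Fin.Subset using (Subset; _∩_; ∣_∣; Nonempty; Empty; _⊆_)
open import Data.Fin.Subset.Properties using (nonempty?)
open import Data.List using (List; map; filter; length)
open import Data.Nat.ListAction using (sum)
open import Data.List.Relation.Unary.All using (All)
open import Data.List.Relation.Unary.AllPairs using (AllPairs)
open import Data.List.Membership.Propositional using (_∈_)
open import Data.Product using (_×_)
open import Data.Sum using (_⊎_)
open import Relation.Binary.PropositionalEquality using (_≡_)
open import Relation.Nullary using (¬_)
import Data.List.Relation.Unary.Any as Any

Family : ℕ → Set
Family n = List (Subset n)

Disjoint : ∀ {n} → Subset n → Subset n → Set
Disjoint u x = Empty (u ∩ x)

IsInstance : ∀ {n} → Family n → Set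
IsInstance {n} 𝒮 =
  (∀ s → s ∈ 𝒮 → Nonempty s × ∣ s ∣ ≤ 3) ×
  (∀ s → s ∈ 𝒮 → ∀ (t : Subset n) → t ⊆ s → Nonempty t → t ∈ 𝒮)

w : ∀ {n} → Subset n → ℕ
w s = ∣ s ∣ ∸ 1

wF : ∀ {n} → Family n → ℕ
wF X = sum (map w X)

count2 : ∀ {n} → Family n → ℕ
count2 X = length (filter (λ s → w s Data.Nat.≟ 2) X)

PairwiseDisjoint : ∀ {n} → Family n → Set
PairwiseDisjoint X = AllPairs Disjoint X

Feasible : ∀ {n} → Family n → Family n → Set
Feasible 𝒮 X = All (_∈ 𝒮) X × PairwiseDisjoint X

N : ∀ {n} → Family n → Family n → Family n
N U W = filter (λ x → Any.any? (λ u → nonempty? (u ∩ x)) U) W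

LocalImprovement : ∀ {n} → Family n → Family n → Family n → Set
LocalImprovement 𝒮 A X =
  Feasible 𝒮 X ×
  (wF X > wF (N X A) ⊎ (wF X ≡ wF (N X A) × count2 X > count2 (N X A)))

Optimum : ∀ {n} → Family n → Family n → Set
Optimum 𝒮 B = Feasible 𝒮 B × (∀ C → Feasible 𝒮 C → wF C ≤ wF B)

{-# OPTIONS --safe #-}
-- Sets of size 1 have weight 0, so assume every a in A has at least two elements, and let F be the
-- set of elements not covered by A. For a few sets D of A, the sets b ∩ (F ∪ ⋃ D), b in B, are
-- pairwise disjoint members of 𝒮 that meet only sets of D, so local optimality bounds their total
-- weight by that of D, with ties decided by the number of sets of weight 2. For D = ∅ this gives
-- |b ∩ F| ≤ 1. Let φ x = |b ∩ F| for the b containing x, and σ a the sum of φ over a. A set b with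
-- |b ∩ F| = 1 contributes |b ∩ ⋃ D|, so the inequality becomes: the sets b ∩ ⋃ D with b ∩ F = ∅
-- weigh at most the sum of w a - σ a over D.
--
-- Each element x of ⋃ A now receives a charge c x such that b in B is charged at least 6 w(b) in
-- total and a in A at most 8 w(a). Elements with φ = 1 have charge 6. An element of a with φ = 0
-- has charge 2 if w a = σ a = 1 (tight), 4 if w a = 1 and σ a = 0 (slack), 4 if w a = σ a = 2, and
-- otherwise 5, except that it has charge 6 if its b also has a tight and a slack element (heavy);
-- then the other elements of a with φ = 0 have charge 4 if σ a = 1. Every way in which this could
-- undercharge b or overcharge a is excluded by the inequality for at most five sets D.
module Submission where

open import Defs
open import Data.Bool.Base using (true; false; if_then_else_)
open import Data.Bool.Properties using () renaming (_≟_ to _≟ᵇ_)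
open import Data.Empty using (⊥-elim)
open import Data.Fin.Base using (Fin; zero; suc)
import Data.Fin.Properties as Fin
open import Data.Fin.Subset
open import Data.Fin.Subset.Properties
open import Data.List.Base using ([]; _∷_; map; filter; length; take)
open import Data.List.Membership.Propositional using (find) renaming (_∈_ to _∈ˡ_)
open import Data.List.Membership.Propositional.Properties using (∈-filter⁺; ∈-filter⁻; ∈-map⁺; ∈-map⁻)
open import Data.List.Properties using (filter-none; length-take; map-cong; map-∘)
open import Data.List.Relation.Unary.All as All using (All; []; _∷_)
import Data.List.Relation.Unary.All.Properties as All
open import Data.List.Relation.Unary.AllPairs as AllPairs using (AllPairs; []; _∷_)
import Data.List.Relation.Unary.AllPairs.Properties as AllPairs
open import Data.List.Relation.Unary.Any using (Any; here; there; any?)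
open import Data.Nat.Base hiding (∣_-_∣)
open import Data.Nat.ListAction using (sum)
open import Data.Nat.Properties
open import Algebra.Properties.CommutativeSemigroup +-commutativeSemigroup using (interchange; x∙yz≈y∙xz)
open import Data.Product using (_×_; _,_; proj₁; proj₂; ∃-syntax)
open import Data.Sum as Sum using (_⊎_; inj₁; inj₂)
open import Data.Vec.Base using ([]; _∷_; here; there)
open import Data.Vec.Properties using (≡-dec)
open import Function using (_∘_)
open import Relation.Binary.Definitions using (tri<; tri≈; tri>)
open import Relation.Binary.PropositionalEquality
open import Relation.Nullary
open import Relation.Nullary.Decidable using (_×-dec_)

private
  variable
    n : ℕ
    s t : Subset n
    f g : Fin n → ℕ
    x y z : Fin n

-- Sums over subsets

∑ : Subset n → (Fin n → ℕ) → ℕ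
∑ []            f = 0
∑ (inside  ∷ s) f = f zero + ∑ s (f ∘ suc)
∑ (outside ∷ s) f = ∑ s (f ∘ suc)

-- The index sets may differ, since an element of `s` outside `t` does no harm where `f` vanishes.
-- Both double counts below rely on this: `φ` vanishes outside `⋃ B`, and `c` outside `⋃ A`.
∑-mono : ∀ (s t : Subset n) →
         (∀ {x} → x ∈ s → f x ≡ 0 ⊎ (x ∈ t × f x ≤ g x)) → ∑ s f ≤ ∑ t g
∑-mono []      []      h = z≤n
∑-mono {f = f} {g} (u ∷ s) (v ∷ t) h = heads u v h
  where
  tails : ∑ s (f ∘ suc) ≤ ∑ t (g ∘ suc)
  tails = ∑-mono s t λ x∈s → Sum.map₂ (λ (p , q) → drop-there p , q) (h (there x∈s))
  heads : ∀ u v → (∀ {x} → x ∈ (u ∷ s) → f x ≡ 0 ⊎ (x ∈ (v ∷ t) × f x ≤ g x)) →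
          ∑ (u ∷ s) f ≤ ∑ (v ∷ t) g
  heads outside outside h = tails
  heads outside inside  h = ≤-trans tails (m≤n+m _ _)
  heads inside  v       h with h here
  heads inside  inside  h | inj₁ e rewrite e = ≤-trans tails (m≤n+m _ _)
  heads inside  outside h | inj₁ e rewrite e = tails
  heads inside  inside  h | inj₂ (_ , p) = +-mono-≤ p tails

∑-monoʳ : ∀ (s : Subset n) → (∀ {x} → x ∈ s → f x ≤ g x) → ∑ s f ≤ ∑ s g
∑-monoʳ s h = ∑-mono s s λ x∈s → inj₂ (x∈s , h x∈s)

∑-const : ∀ (s : Subset n) k → ∑ s (λ _ → k) ≡ ∣ s ∣ * k
∑-const []            k = refl
∑-const (inside  ∷ s) k = cong (k +_) (∑-const s k)
∑-const (outside ∷ s) k = ∑-const s k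

∑-+ : ∀ (s : Subset n) f g → ∑ s (λ x → f x + g x) ≡ ∑ s f + ∑ s g
∑-+ []            f g = refl
∑-+ (inside  ∷ s) f g = trans (cong (f zero + g zero +_) (∑-+ s _ _))
                              (interchange (f zero) (g zero) _ _)
∑-+ (outside ∷ s) f g = ∑-+ s _ _

∑-1 : ∀ (s : Subset n) → ∑ s (λ _ → 1) ≡ ∣ s ∣
∑-1 s = trans (∑-const s 1) (*-identityʳ ∣ s ∣)

∑-* : ∀ (s : Subset n) k f → ∑ s (λ x → k * f x) ≡ k * ∑ s f
∑-* []            k f = sym (*-zeroʳ k)
∑-* (inside  ∷ s) k f = trans (cong (k * f zero +_) (∑-* s k _)) (sym (*-distribˡ-+ k (f zero) _))
∑-* (outside ∷ s) k f = ∑-* s k _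

∑-⊥ : ∀ (f : Fin n → ℕ) → ∑ ⊥ f ≡ 0
∑-⊥ {zero}  f = refl
∑-⊥ {suc n} f = ∑-⊥ (f ∘ suc)

∑-∪ : ∀ (s t : Subset n) f → Disjoint s t → ∑ (s ∪ t) f ≡ ∑ s f + ∑ t f
∑-∪ []            []            f d = refl
∑-∪ (inside  ∷ s) (inside  ∷ t) f d = ⊥-elim (d (zero , here))
∑-∪ (inside  ∷ s) (outside ∷ t) f d =
  trans (cong (f zero +_) (∑-∪ s t _ (drop-∷-Empty d))) (sym (+-assoc (f zero) _ _))
∑-∪ (outside ∷ s) (inside  ∷ t) f d =
  trans (cong (f zero +_) (∑-∪ s t _ (drop-∷-Empty d))) (x∙yz≈y∙xz (f zero) (∑ s _) _)
∑-∪ (outside ∷ s) (outside ∷ t) f d = ∑-∪ s t _ (drop-∷-Empty d)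

∑-remove : ∀ f → x ∈ s → f x + ∑ (s - x) f ≡ ∑ s f
∑-remove {s = _ ∷ s}       f here        = cong (λ s → f zero + ∑ s (f ∘ suc)) (p─⊥≡p s)
∑-remove {s = inside ∷ s}  f (there {i = x} x∈s) =
  trans (x∙yz≈y∙xz (f (suc x)) (f zero) _) (cong (f zero +_) (∑-remove (f ∘ suc) x∈s))
∑-remove {s = outside ∷ s} f (there x∈s) = ∑-remove (f ∘ suc) x∈s

∣-∣-remove : x ∈ s → suc ∣ s - x ∣ ≡ ∣ s ∣
∣-∣-remove {x = x} {s = s} x∈s =
  subst₂ (λ k l → suc k ≡ l) (∑-1 (s - x)) (∑-1 s) (∑-remove (λ _ → 1) x∈s)

x∉p-x : ∀ (p : Subset n) → x ∉ p - x
x∉p-x {x = zero}  (inside  ∷ p) ()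
x∉p-x {x = zero}  (outside ∷ p) ()
x∉p-x {x = suc x} (v ∷ p) (there q) = x∉p-x p q

∈-remove⁻ : ∀ (s : Subset n) → y ∈ s - x → y ∈ s × x ≢ y
∈-remove⁻ s y∈ = p─q⊆p s _ y∈ , λ { refl → x∉p-x s y∈ }

∑-pair : ∀ f → x ∈ s → y ∈ s → x ≢ y → f x + f y ≤ ∑ s f
∑-pair {x = x} {s = s} {y = y} f x∈s y∈s x≢y = begin
  f x + f y                     ≤⟨ +-monoʳ-≤ (f x) (m≤m+n (f y) _) ⟩
  f x + (f y + ∑ (s - x - y) f) ≡⟨ cong (f x +_) (∑-remove f (x∈p∧x≢y⇒x∈p-y y∈s (x≢y ∘ sym))) ⟩
  f x + ∑ (s - x) f             ≡⟨ ∑-remove f x∈s ⟩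
  ∑ s f                         ∎
  where open ≤-Reasoning

∑-triple : ∀ f → x ∈ s → y ∈ s → z ∈ s → x ≢ y → x ≢ z → y ≢ z → f x + (f y + f z) ≤ ∑ s f
∑-triple {x = x} {s = s} {y = y} {z = z} f x∈s y∈s z∈s x≢y x≢z y≢z = begin
  f x + (f y + f z) ≤⟨ +-monoʳ-≤ (f x) (∑-pair f (x∈p∧x≢y⇒x∈p-y y∈s (x≢y ∘ sym))
                                                 (x∈p∧x≢y⇒x∈p-y z∈s (x≢z ∘ sym)) y≢z) ⟩
  f x + ∑ (s - x) f ≡⟨ ∑-remove f x∈s ⟩
  ∑ s f             ∎
  where open ≤-Reasoning

2≤∣-∣ : x ∈ s → y ∈ s → x ≢ y → 2 ≤ ∣ s ∣
2≤∣-∣ {s = s} x∈s y∈s x≢y =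
  subst (2 ≤_) (∑-1 s) (∑-pair (λ _ → 1) x∈s y∈s x≢y)

3≤∣-∣ : x ∈ s → y ∈ s → z ∈ s → x ≢ y → x ≢ z → y ≢ z → 3 ≤ ∣ s ∣
3≤∣-∣ {s = s} x∈s y∈s z∈s x≢y x≢z y≢z =
  subst (3 ≤_) (∑-1 s) (∑-triple (λ _ → 1) x∈s y∈s z∈s x≢y x≢z y≢z)

∑-pos : ∀ (s : Subset n) f → 0 < ∑ s f → ∃[ x ] x ∈ s × 0 < f x
∑-pos (outside ∷ s) f 0<∑ with ∑-pos s _ 0<∑
... | x , x∈s , 0<fx = suc x , there x∈s , 0<fx
∑-pos (inside ∷ s) f 0<∑ with f zero in eq
... | suc k = zero , here , subst (0 <_) (sym eq) z<s
... | zero with ∑-pos s _ 0<∑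
...   | x , x∈s , 0<fx = suc x , there x∈s , 0<fx

0<∣-∣⇒Nonempty : ∀ (s : Subset n) → 0 < ∣ s ∣ → Nonempty s
0<∣-∣⇒Nonempty s 0<∣s∣
  with ∑-pos s (λ _ → 1) (subst (0 <_) (sym (∑-1 s)) 0<∣s∣)
... | x , x∈s , _ = x , x∈s

∣-∣≡0⇒∉ : ∀ (s : Subset n) → ∣ s ∣ ≡ 0 → x ∉ s
∣-∣≡0⇒∉ s ∣s∣≡0 x∈s = contradiction (trans (∣-∣-remove x∈s) ∣s∣≡0) λ ()

-- Sums over families of sets

total : (Subset n → ℕ) → Family n → ℕ
total f Y = sum (map f Y)

total-mono : ∀ {f g : Subset n → ℕ} Y → (∀ {s} → s ∈ˡ Y → f s ≤ g s) → total f Y ≤ total g Y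
total-mono []      h = z≤n
total-mono (s ∷ Y) h = +-mono-≤ (h (here refl)) (total-mono Y (h ∘ there))

total-+ : ∀ (f g : Subset n → ℕ) Y → total (λ s → f s + g s) Y ≡ total f Y + total g Y
total-+ f g []      = refl
total-+ f g (s ∷ Y) = trans (cong (f s + g s +_) (total-+ f g Y)) (interchange (f s) (g s) _ _)

total-* : ∀ k (f : Subset n → ℕ) Y → total (λ s → k * f s) Y ≡ k * total f Y
total-* k f []      = sym (*-zeroʳ k)
total-* k f (s ∷ Y) = trans (cong (k * f s +_) (total-* k f Y)) (sym (*-distribˡ-+ k (f s) _))

total-∈ : ∀ (f : Subset n → ℕ) {s Y} → s ∈ˡ Y → f s ≤ total f Y
total-∈ f (here refl) = m≤m+n _ _
total-∈ f (there s∈Y) = ≤-trans (total-∈ f s∈Y) (m≤n+m _ _)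

total-pair : ∀ (f : Subset n → ℕ) {s t Y} → s ∈ˡ Y → t ∈ˡ Y → s ≢ t → f s + f t ≤ total f Y
total-pair f (here refl) (here refl) s≢t = contradiction refl s≢t
total-pair f (here refl) (there t∈Y) s≢t = +-monoʳ-≤ _ (total-∈ f t∈Y)
total-pair f {s} {t} (there s∈Y) (here refl) s≢t =
  ≤-trans (≤-reflexive (+-comm (f s) (f t))) (+-monoʳ-≤ (f t) (total-∈ f s∈Y))
total-pair f (there s∈Y) (there t∈Y) s≢t = ≤-trans (total-pair f s∈Y t∈Y s≢t) (m≤n+m _ _)

total-filter : ∀ {ℓ} {P : Subset n → Set ℓ} (P? : ∀ s → Dec (P s)) (f : Subset n → ℕ) Y →
               (∀ {s} → ¬ P s → f s ≡ 0) → total f (filter P? Y) ≡ total f Y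
total-filter P? f []      h = refl
total-filter P? f (s ∷ Y) h with P? s
... | yes _ = cong (f s +_) (total-filter P? f Y h)
... | no ¬p = trans (total-filter P? f Y h) (cong (_+ total f Y) (sym (h ¬p)))

total-filter-mono : ∀ {ℓ₁ ℓ₂} {P : Subset n → Set ℓ₁} {Q : Subset n → Set ℓ₂}
                    (P? : ∀ s → Dec (P s)) (Q? : ∀ s → Dec (Q s)) (f : Subset n → ℕ) Y →
                    (∀ {s} → s ∈ˡ Y → P s → Q s) → total f (filter P? Y) ≤ total f (filter Q? Y)
total-filter-mono P? Q? f []      h = z≤n
total-filter-mono P? Q? f (s ∷ Y) h with P? s | Q? s | total-filter-mono P? Q? f Y (h ∘ there)
... | yes p | yes _ | ih = +-monoʳ-≤ (f s) ih
... | yes p | no ¬q | ih = contradiction (h (here refl) p) ¬q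
... | no _  | yes _ | ih = ≤-trans ih (m≤n+m _ _)
... | no _  | no _  | ih = ih

_≟ˢ_ : (s t : Subset n) → Dec (s ≡ t)
_≟ˢ_ = ≡-dec _≟ᵇ_

_∈ˡ?_ : (s : Subset n) (Y : Family n) → Dec (s ∈ˡ Y)
s ∈ˡ? Y = any? (s ≟ˢ_) Y

-- Without repetitions only one entry of `Y` can be `t`, so after an entry that satisfies `P` but
-- not `Q` the rest is settled by `total-filter-mono`.
total-filter-except : ∀ {ℓ₁ ℓ₂} {P : Subset n → Set ℓ₁} {Q : Subset n → Set ℓ₂}
                      (P? : ∀ s → Dec (P s)) (Q? : ∀ s → Dec (Q s)) (f : Subset n → ℕ) {t Y} →
                      AllPairs _≢_ Y → (∀ {s} → P s → s ≡ t ⊎ Q s) →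
                      total f (filter P? Y) ≤ f t + total f (filter Q? Y)
total-filter-except P? Q? f []                    h = z≤n
total-filter-except P? Q? f {t} {s ∷ Y} (s∉Y ∷ u) h
  with P? s | Q? s | total-filter-except P? Q? f u h
... | yes p | yes q | ih = ≤-trans (+-monoʳ-≤ (f s) ih) (≤-reflexive (x∙yz≈y∙xz (f s) (f t) _))
... | no _  | yes _ | ih = ≤-trans ih (+-monoʳ-≤ (f t) (m≤n+m _ _))
... | no _  | no _  | ih = ih
... | yes p | no ¬q | _ with h p
...   | inj₂ q    = contradiction q ¬q
...   | inj₁ refl = +-monoʳ-≤ (f s) (total-filter-mono P? Q? f Y λ s′∈Y p′ → other s′∈Y (h p′))
  where
  other : ∀ {s′} → s′ ∈ˡ Y → s′ ≡ s ⊎ _ → _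
  other s′∈Y (inj₁ refl) = contradiction refl (All.lookup s∉Y s′∈Y)
  other s′∈Y (inj₂ q)    = q

-- Repetitions in `L`, or sets outside `Y`, only increase the right-hand side. Lists of sets to be
-- removed can therefore be written down without deciding which of them coincide.
total-members : ∀ (f : Subset n → ℕ) (L : Family n) {Y} → AllPairs _≢_ Y →
                total f (filter (_∈ˡ? L) Y) ≤ total f L
total-members f []      {Y} u =
  ≤-reflexive (cong (total f) (filter-none (_∈ˡ? []) (All.universal (λ _ ()) Y)))
total-members f (l ∷ L) u = ≤-trans
  (total-filter-except (_∈ˡ? (l ∷ L)) (_∈ˡ? L) f u λ { (here e) → inj₁ e ; (there s∈L) → inj₂ s∈L })
  (+-monoʳ-≤ (f l) (total-members f L u))

-- Unions of families and the member that contains an element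

∈⋃⁺ : ∀ {s : Subset n} {Y} → s ∈ˡ Y → x ∈ s → x ∈ ⋃ Y
∈⋃⁺ (here refl) x∈s = x∈p∪q⁺ (inj₁ x∈s)
∈⋃⁺ (there s∈Y) x∈s = x∈p∪q⁺ (inj₂ (∈⋃⁺ s∈Y x∈s))

∈⋃⁻ : ∀ (Y : Family n) → x ∈ ⋃ Y → ∃[ s ] s ∈ˡ Y × x ∈ s
∈⋃⁻ []      x∈ = contradiction x∈ ∉⊥
∈⋃⁻ (s ∷ Y) x∈ with x∈p∪q⁻ s (⋃ Y) x∈
... | inj₁ x∈s = s , here refl , x∈s
... | inj₂ x∈⋃ with ∈⋃⁻ Y x∈⋃
...   | t , t∈Y , x∈t = t , there t∈Y , x∈t

disjoint⇒∉ : Disjoint s t → x ∈ s → x ∉ t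
disjoint⇒∉ d x∈s x∈t = d (_ , x∈p∩q⁺ (x∈s , x∈t))

total-∑ : ∀ (f : Fin n → ℕ) {Y} → PairwiseDisjoint Y → total (λ s → ∑ s f) Y ≡ ∑ (⋃ Y) f
total-∑ f []            = sym (∑-⊥ f)
total-∑ f {s ∷ Y} (d ∷ ds) =
  trans (cong (∑ s f +_) (total-∑ f ds)) (sym (∑-∪ s (⋃ Y) f disj))
  where
  disj : Disjoint s (⋃ Y)
  disj (x , x∈) with x∈p∩q⁻ s (⋃ Y) x∈
  ... | x∈s , x∈⋃ with ∈⋃⁻ Y x∈⋃
  ...   | t , t∈Y , x∈t = disjoint⇒∉ (All.lookup d t∈Y) x∈s x∈t

-- The default `⊥` has size 0, which makes `φ` vanish outside `⋃ B` and `c` vanish outside `⋃ A`.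
owner : Family n → Fin n → Subset n
owner []      x = ⊥
owner (s ∷ Y) x with x ∈? s
... | yes _ = s
... | no  _ = owner Y x

owner-unique : ∀ {Y : Family n} → PairwiseDisjoint Y → s ∈ˡ Y → x ∈ s → owner Y x ≡ s
owner-unique {x = x} {Y = t ∷ Y} (d ∷ ds) s∈ x∈s with x ∈? t | s∈
... | yes _   | here refl = refl
... | yes x∈t | there s∈Y = contradiction x∈s (disjoint⇒∉ (All.lookup d s∈Y) x∈t)
... | no x∉t  | here refl = contradiction x∈s x∉t
... | no _    | there s∈Y = owner-unique ds s∈Y x∈s

owner-outside : ∀ (Y : Family n) → x ∉ ⋃ Y → owner Y x ≡ ⊥
owner-outside []      x∉ = refl
owner-outside {x = x} (t ∷ Y) x∉ with x ∈? t
... | yes x∈t = contradiction (x∈p∪q⁺ (inj₁ x∈t)) x∉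
... | no _    = owner-outside Y (x∉ ∘ x∈p∪q⁺ ∘ inj₂)

∈-owner : ∀ (Y : Family n) → x ∈ ⋃ Y → owner Y x ∈ˡ Y × x ∈ owner Y x
∈-owner []      x∈ = contradiction x∈ ∉⊥
∈-owner {x = x} (t ∷ Y) x∈ with x ∈? t
... | yes x∈t = here refl , x∈t
... | no x∉t with x∈p∪q⁻ t (⋃ Y) x∈
...   | inj₁ x∈t = contradiction x∈t x∉t
...   | inj₂ x∈⋃ with ∈-owner Y x∈⋃
...     | o∈Y , x∈o = there o∈Y , x∈o

-- The lexicographic comparison as a single number

-- Maximising `value` is maximising (weight, number of weight-2 sets) lexicographically
-- as long as the weight that is given up is at most 9; see `lexicographic`.
bonus : ℕ → ℕ
bonus 3 = 1
bonus _ = 0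

value : ℕ → ℕ
value k = 10 * (k ∸ 1) + bonus k

V : Subset n → ℕ
V s = value ∣ s ∣

bonus≤ : ∀ k → bonus k ≤ k ∸ 1
bonus≤ 0 = z≤n
bonus≤ 1 = z≤n
bonus≤ 2 = z≤n
bonus≤ 3 = s≤s z≤n
bonus≤ (suc (suc (suc (suc k)))) = z≤n

count2-total : ∀ (X : Family n) → count2 X ≡ total (bonus ∘ ∣_∣) X
count2-total []      = refl
count2-total (s ∷ X) with ∣ s ∣
... | 0 = count2-total X
... | 1 = count2-total X
... | 2 = count2-total X
... | 3 = cong suc (count2-total X)
... | suc (suc (suc (suc k))) = count2-total X

total-V : ∀ (X : Family n) → total V X ≡ 10 * wF X + count2 X
total-V X = begin
  total V X                                        ≡⟨ total-+ (λ s → 10 * w s) (bonus ∘ ∣_∣) X ⟩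
  total (λ s → 10 * w s) X + total (bonus ∘ ∣_∣) X ≡⟨ cong₂ _+_ (total-* 10 w X) (sym (count2-total X)) ⟩
  10 * wF X + count2 X                             ∎
  where open ≡-Reasoning

-- The case to exclude is `p < p′` with the loss made up by `q`. There `q ≤ p < p′ ≤ 9`, so `q`
-- cannot outweigh one unit of weight, which counts 10.
lexicographic : ∀ {p q p′ q′} → q ≤ p → p′ ≤ 9 → 10 * p′ + q′ < 10 * p + q →
                p′ < p ⊎ (p ≡ p′ × q′ < q)
lexicographic {p} {q} {p′} {q′} q≤p p′≤9 lt with <-cmp p p′
... | tri> _ _ p′<p    = inj₁ p′<p
... | tri≈ _ refl _    = inj₂ (refl , +-cancelˡ-< (10 * p) _ _ lt)
... | tri< p<p′ _ _    = contradiction lt (≤⇒≯ (begin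
  10 * p + q   ≤⟨ +-monoʳ-≤ (10 * p) (≤-trans q≤p (≤-trans (<⇒≤ p<p′) (≤-trans p′≤9 (n≤1+n 9)))) ⟩
  10 * p + 10  ≡⟨ trans (+-comm (10 * p) 10) (sym (*-suc 10 p)) ⟩
  10 * suc p   ≤⟨ *-monoʳ-≤ 10 p<p′ ⟩
  10 * p′      ≤⟨ m≤m+n (10 * p′) q′ ⟩
  10 * p′ + q′ ∎))
  where open ≤-Reasoning

value-mono : ∀ {k l} → k ≤ l → l ≤ 3 → value k ≤ value l
value-mono {0} _ _ = z≤n
value-mono {1} _ _ = z≤n
value-mono {2} {2} _ _ = ≤-refl
value-mono {2} {3} _ _ = m≤m+n 10 11
value-mono {3} {3} _ _ = ≤-refl
value-mono {l = suc (suc (suc (suc l)))} _ (s≤s (s≤s (s≤s ())))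
value-mono {2} {1} (s≤s ()) _
value-mono {3} {1} (s≤s ()) _
value-mono {3} {2} (s≤s (s≤s ())) _
value-mono {suc (suc (suc (suc k)))} {3} (s≤s (s≤s (s≤s ()))) _
value-mono {suc (suc (suc (suc k)))} {2} (s≤s (s≤s ())) _
value-mono {suc (suc (suc (suc k)))} {1} (s≤s ()) _

value<2 : ∀ {k} → ¬ 2 ≤ k → value k ≡ 0
value<2 {0} _ = refl
value<2 {1} _ = refl
value<2 {suc (suc k)} k≱2 = contradiction (s≤s (s≤s z≤n)) k≱2

-- The bonus is below 10, so division by 10 discards it.
value-quotient : ∀ {m} k → 10 * m ≤ value k → m ≤ k ∸ 1
value-quotient {m} k le = s≤s⁻¹ (*-cancelˡ-< 10 m (suc (k ∸ 1)) (begin-strict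
  10 * m                  ≤⟨ le ⟩
  10 * (k ∸ 1) + bonus k  <⟨ +-monoʳ-< (10 * (k ∸ 1)) (bonus<10 k) ⟩
  10 * (k ∸ 1) + 10       ≡⟨ trans (+-comm (10 * (k ∸ 1)) 10) (sym (*-suc 10 (k ∸ 1))) ⟩
  10 * suc (k ∸ 1)        ∎))
  where
  open ≤-Reasoning
  bonus<10 : ∀ k → bonus k < 10
  bonus<10 0 = z<s
  bonus<10 1 = z<s
  bonus<10 2 = z<s
  bonus<10 3 = s<s z<s
  bonus<10 (suc (suc (suc (suc k)))) = z<s

-- With f free elements and m elements of removed sets in some b in B, the value of b is credited
-- to the m elements if f > 0, and to b itself if f = 0.
fullValue : ℕ → ℕ → ℕ
fullValue zero    k = value k
fullValue (suc _) _ = 0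

-- As `f + m ≤ 3`, the credit `m * (10 * f)` is nonzero only for `(f , m)` equal to (1, 1), (1, 2)
-- or (2, 1). It is then 10, 20 or 20, against a value of at least 10, 21 or 21.
value-split : ∀ f m {k} → f + m ≤ k → k ≤ 3 → fullValue f k + m * (10 * f) ≤ value k
value-split 0 m {k} _ _ = ≤-reflexive (trans (cong (value k +_) (*-zeroʳ m)) (+-identityʳ (value k)))
value-split (suc f) 0 _ _ = z≤n
value-split 1 1 f+m≤k k≤3 = value-mono f+m≤k k≤3
value-split 1 2 f+m≤k k≤3 = ≤-trans (m≤m+n 20 1) (value-mono f+m≤k k≤3)
value-split 2 1 f+m≤k k≤3 = ≤-trans (m≤m+n 20 1) (value-mono f+m≤k k≤3)
value-split 1 (suc (suc (suc m))) p q with ≤-trans p q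
... | s≤s (s≤s (s≤s ()))
value-split 2 (suc (suc m)) p q with ≤-trans p q
... | s≤s (s≤s (s≤s ()))
value-split (suc (suc (suc f))) (suc m) p q with ≤-trans p q
... | s≤s (s≤s (s≤s le)) rewrite +-suc f m = contradiction le λ ()

restrict-disjoint : ∀ (C : Subset n) {Y} → PairwiseDisjoint Y → PairwiseDisjoint (map (_∩ C) Y)
restrict-disjoint C = AllPairs.map⁺ ∘ AllPairs.map λ {s} {t} d (x , x∈) →
  let x∈s∩C , x∈t∩C = x∈p∩q⁻ (s ∩ C) (t ∩ C) x∈
  in disjoint⇒∉ {s = s} {t = t} d (p∩q⊆p s C x∈s∩C) (p∩q⊆p t C x∈t∩C)

∣-∣-disjoint : ∀ (s t u : Subset n) → s ⊆ u → t ⊆ u → Disjoint s t → ∣ s ∣ + ∣ t ∣ ≤ ∣ u ∣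
∣-∣-disjoint s t u s⊆u t⊆u d = begin
  ∣ s ∣ + ∣ t ∣                     ≡⟨ cong₂ _+_ (∑-1 s) (∑-1 t) ⟨
  ∑ s (λ _ → 1) + ∑ t (λ _ → 1)     ≡⟨ ∑-∪ s t _ d ⟨
  ∑ (s ∪ t) (λ _ → 1)               ≤⟨ ∑-mono (s ∪ t) u (λ x∈ → inj₂ (incl (x∈p∪q⁻ s t x∈) , ≤-refl)) ⟩
  ∑ u (λ _ → 1)                     ≡⟨ ∑-1 u ⟩
  ∣ u ∣                             ∎
  where
  open ≤-Reasoning
  incl : ∀ {x} → x ∈ s ⊎ x ∈ t → x ∈ u
  incl (inj₁ x∈s) = s⊆u x∈s
  incl (inj₂ x∈t) = t⊆u x∈t

disjoint⇒unique : ∀ {Y : Family n} → All Nonempty Y → PairwiseDisjoint Y → AllPairs _≢_ Y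
disjoint⇒unique []                  []       = []
disjoint⇒unique ((x , x∈s) ∷ ne) (d ∷ ds) =
  All.map (λ { s∩t=∅ refl → s∩t=∅ (x , x∈p∩q⁺ (x∈s , x∈s)) }) d ∷ disjoint⇒unique ne ds

Any-take⁻ : ∀ {P : Subset n → Set} k Y → Any P (take k Y) → Any P Y
Any-take⁻ (suc k) (s ∷ Y) (here p)  = here p
Any-take⁻ (suc k) (s ∷ Y) (there p) = there (Any-take⁻ k Y p)

-- Arithmetic of the charges

rate : ℕ × ℕ × ℕ → ℕ → ℕ → ℕ
rate (p , q , r) φ h = p + (q * φ + r * h)

-- The charge, in sixths of a unit of weight, of an element of a set a of A, as an affine function
-- of φ and h, with coefficients determined by ∣ a ∣, σ a and η a. The budget of a is 8 * w a.
coefficients : ℕ → ℕ → ℕ → ℕ × ℕ × ℕ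
coefficients 2 0             _       = 4 , 2 , 0
coefficients 2 (suc _)       _       = 2 , 4 , 0
coefficients 3 0             _       = 5 , 1 , 1
coefficients 3 1             0       = 5 , 1 , 0
coefficients 3 1             (suc _) = 4 , 2 , 2
coefficients 3 (suc (suc _)) _       = 4 , 2 , 0
coefficients _ _             _       = 0 , 0 , 0

-- Every case is an equality except `m = 3`, `k = e = 0`, where one sixth is left over; a heavy
-- element would use it up. For `m = 2` the coefficient of `h` is 0, so heavy elements have to be
-- counted for `m = 3` only.
budget : ∀ m k e → 2 ≤ m → m ≤ 3 → k ≤ m ∸ 1 → (m ≡ 3 → e ≤ 1) →
         let (p , q , r) = coefficients m k e in m * p + (q * k + r * e) ≤ 8 * (m ∸ 1)
budget 1 _ _ (s≤s ()) _ _ _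
budget 2 0 e _ _ _ _ = ≤-refl
budget 2 1 e _ _ _ _ = ≤-refl
budget 2 (suc (suc k)) e _ _ (s≤s ()) _
budget 3 0 e _ _ _ e≤1 = +-monoʳ-≤ 15 (≤-trans (≤-reflexive (+-identityʳ e)) (e≤1 refl))
budget 3 1 0 _ _ _ _ = ≤-refl
budget 3 1 1 _ _ _ _ = ≤-refl
budget 3 1 (suc (suc e)) _ _ _ e≤1 = contradiction (e≤1 refl) λ { (s≤s ()) }
budget 3 2 e _ _ _ _ = ≤-refl
budget 3 (suc (suc (suc k))) e _ _ (s≤s (s≤s ())) _
budget (suc (suc (suc (suc m)))) _ _ _ (s≤s (s≤s (s≤s ()))) _ _

-- Each row of `coefficients` with size 2 or 3 has `p + q = 6`.
rate≥6 : ∀ m k e h → 2 ≤ m → m ≤ 3 → 6 ≤ rate (coefficients m k e) 1 h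
rate≥6 1 _ _ _ (s≤s ()) _
rate≥6 2 0 e h _ _ = m≤m+n 6 _
rate≥6 2 (suc k) e h _ _ = m≤m+n 6 _
rate≥6 3 0 e h _ _ = m≤m+n 6 _
rate≥6 3 1 0 h _ _ = m≤m+n 6 _
rate≥6 3 1 (suc e) h _ _ = m≤m+n 6 _
rate≥6 3 (suc (suc k)) e h _ _ = m≤m+n 6 _
rate≥6 (suc (suc (suc (suc m)))) _ _ _ _ (s≤s (s≤s (s≤s ())))

rate≥4 : ∀ m k e φ h → 2 ≤ m → m ≤ 3 → k ≤ m ∸ 1 → ¬ (m ≡ 2 × k ≡ 1) → 4 ≤ rate (coefficients m k e) φ h
rate≥4 1 _ _ _ _ (s≤s ()) _ _ _
rate≥4 2 0 e φ h _ _ _ _ = m≤m+n 4 _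
rate≥4 2 1 e φ h _ _ _ ¬tight = contradiction (refl , refl) ¬tight
rate≥4 2 (suc (suc k)) e φ h _ _ (s≤s ()) _
rate≥4 3 0 e φ h _ _ _ _ = m≤m+n 4 _
rate≥4 3 1 0 φ h _ _ _ _ = m≤m+n 4 _
rate≥4 3 1 (suc e) φ h _ _ _ _ = m≤m+n 4 _
rate≥4 3 (suc (suc k)) e φ h _ _ _ _ = m≤m+n 4 _
rate≥4 (suc (suc (suc (suc m)))) _ _ _ _ _ (s≤s (s≤s (s≤s ()))) _ _

rate-3-0 : ∀ {e h} φ → h ≡ 1 → 6 ≤ rate (coefficients 3 0 e) φ h
rate-3-0 φ refl = +-monoʳ-≤ 5 (m≤n+m 1 (1 * φ))

rate-3-1 : ∀ {e h} φ → 0 < e → h ≡ 1 → 6 ≤ rate (coefficients 3 1 e) φ h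
rate-3-1 {suc e} φ _ refl = +-monoʳ-≤ 4 (m≤n+m 2 (2 * φ))

indicator : {P : Set} → Dec P → ℕ
indicator P? = if does P? then 1 else 0

indicator-yes : {P : Set} (P? : Dec P) → P → indicator P? ≡ 1
indicator-yes (yes _) _ = refl
indicator-yes (no ¬p) p = contradiction p ¬p

indicator-pos : {P : Set} (P? : Dec P) → 0 < indicator P? → P
indicator-pos (yes p) _ = p

indicator≤1 : {P : Set} (P? : Dec P) → indicator P? ≤ 1
indicator≤1 (yes _) = ≤-refl
indicator≤1 (no _)  = z≤n

big? : ∀ (s : Subset n) → Dec (2 ≤ ∣ s ∣)
big? s = 2 ≤? ∣ s ∣

-- Local optimality as an inequality between values

module LocalOptimum {𝒮 A B : Family n} (inst : IsInstance 𝒮)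
  (A-feasible : Feasible 𝒮 A) (A-big : All (λ a → 2 ≤ ∣ a ∣) A) (B-feasible : Feasible 𝒮 B)
  (no-improvement : ∀ X → length X ≤ 10 → ¬ LocalImprovement 𝒮 A X) where

  A-disjoint : PairwiseDisjoint A
  A-disjoint = proj₂ A-feasible

  B-disjoint : PairwiseDisjoint B
  B-disjoint = proj₂ B-feasible

  A-unique : AllPairs _≢_ A
  A-unique = disjoint⇒unique (All.map (λ a∈𝒮 → proj₁ (proj₁ inst _ a∈𝒮)) (proj₁ A-feasible)) A-disjoint

  A-size≤3 : s ∈ˡ A → ∣ s ∣ ≤ 3
  A-size≤3 s∈A = proj₂ (proj₁ inst _ (All.lookup (proj₁ A-feasible) s∈A))

  B-size≤3 : s ∈ˡ B → ∣ s ∣ ≤ 3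
  B-size≤3 s∈B = proj₂ (proj₁ inst _ (All.lookup (proj₁ B-feasible) s∈B))

  members : Family n → Family n
  members L = filter (_∈ˡ? L) A

  Touches : Family n → Subset n → Set
  Touches X a = Any (λ u → Nonempty (u ∩ a)) X

  touches? : ∀ X a → Dec (Touches X a)
  touches? X a = any? (λ u → nonempty? (u ∩ a)) X

  -- The neighborhood of `X` lies in `members L`, so if `X` has at most 10 sets, an excess in value
  -- is a local improvement by `lexicographic`. The bound 9 serves twice: it is the hypothesis of
  -- `lexicographic`, and it is exceeded by the weight of any ten sets of `X`, which removes the
  -- restriction on the size of `X`.
  no-gain : ∀ L X → Feasible 𝒮 X → All (λ s → 2 ≤ ∣ s ∣) X →
            (∀ {a} → a ∈ˡ A → Touches X a → a ∈ˡ L) → wF (members L) ≤ 9 →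
            total V X ≤ total V (members L)
  no-gain L X (X⊆𝒮 , X-disjoint) X-big touches⇒∈ w≤9 with total V X ≤? total V (members L)
  ... | yes le = le
  ... | no ¬le with length X ≤? 10
  ...   | yes short = contradiction ((X⊆𝒮 , X-disjoint) , better) (no-improvement X short)
    where
    open ≤-Reasoning
    count2≤wF : count2 X ≤ wF X
    count2≤wF = subst (_≤ wF X) (sym (count2-total X)) (total-mono X λ {s} _ → bonus≤ ∣ s ∣)
    N≤ : ∀ f → total f (N X A) ≤ total f (members L)
    N≤ f = total-filter-mono (touches? X) (_∈ˡ? L) f A touches⇒∈
    better : wF X > wF (N X A) ⊎ (wF X ≡ wF (N X A) × count2 X > count2 (N X A))
    better = lexicographic count2≤wF (≤-trans (N≤ w) w≤9) (begin-strict
      10 * wF (N X A) + count2 (N X A) ≡⟨ total-V (N X A) ⟨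
      total V (N X A)                  ≤⟨ N≤ V ⟩
      total V (members L)              <⟨ ≰⇒> ¬le ⟩
      total V X                        ≡⟨ total-V X ⟩
      10 * wF X + count2 X             ∎)
  -- Every set of X has positive weight, so ten of them already outweigh members L.
  ...   | no long = contradiction ((All.take⁺ 10 X⊆𝒮 , AllPairs.take⁺ 10 X-disjoint) , inj₁ better)
                      (no-improvement X′ (≤-reflexive length-X′))
    where
    open ≤-Reasoning
    X′ : Family n
    X′ = take 10 X
    length-X′ : length X′ ≡ 10
    length-X′ = trans (length-take 10 X) (m≤n⇒m⊓n≡m (<⇒≤ (≰⇒> long)))
    length≤wF : ∀ {Y : Family n} → All (λ s → 2 ≤ ∣ s ∣) Y → length Y ≤ wF Y
    length≤wF []       = z≤n
    length≤wF (p ∷ ps) = +-mono-≤ (∸-monoˡ-≤ 1 p) (length≤wF ps)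
    better : wF (N X′ A) < wF X′
    better = begin-strict
      wF (N X′ A)    ≤⟨ total-filter-mono (touches? X′) (_∈ˡ? L) w A (λ a∈A t → touches⇒∈ a∈A (Any-take⁻ 10 X t)) ⟩
      wF (members L) ≤⟨ w≤9 ⟩
      9              <⟨ n<1+n 9 ⟩
      10             ≡⟨ length-X′ ⟨
      length X′      ≤⟨ length≤wF (All.take⁺ 10 X-big) ⟩
      wF X′          ∎

  -- U L is what becomes available once the sets in L are removed from A.
  F : Subset n
  F = ∁ (⋃ A)

  U : Family n → Subset n
  U L = ∁ (⋃ (filter (λ a → ¬? (a ∈ˡ? L)) A))

  ∈U⁺ : ∀ L → (∀ {a} → a ∈ˡ A → x ∈ a → a ∈ˡ L) → x ∈ U L
  ∈U⁺ L h = x∉p⇒x∈∁p λ x∈⋃ →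
    let a , a∈ , x∈a = ∈⋃⁻ (filter (λ a → ¬? (a ∈ˡ? L)) A) x∈⋃
        a∈A , a∉L    = ∈-filter⁻ (λ a → ¬? (a ∈ˡ? L)) a∈
    in a∉L (h a∈A x∈a)

  ∈U⁻ : ∀ L → x ∈ U L → s ∈ˡ A → x ∈ s → s ∈ˡ L
  ∈U⁻ L x∈U s∈A x∈s with _ ∈ˡ? L
  ... | yes s∈L = s∈L
  ... | no s∉L  = contradiction (∈⋃⁺ (∈-filter⁺ (λ a → ¬? (a ∈ˡ? L)) s∈A s∉L) x∈s) (x∈∁p⇒x∉p x∈U)

  F⊆U : ∀ L → F ⊆ U L
  F⊆U L x∈F = ∈U⁺ L λ a∈A x∈a → contradiction (∈⋃⁺ a∈A x∈a) (x∈∁p⇒x∉p x∈F)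

  -- The restricted sets are in the instance by heredity once the empty ones are gone. Dropping
  -- everything with fewer than two elements loses no value and leaves only sets of positive weight,
  -- as `no-gain` demands.
  exchange : ∀ L → wF (members L) ≤ 9 → total (λ b → V (b ∩ U L)) B ≤ total V (members L)
  exchange L w≤9 = begin
    total (λ b → V (b ∩ U L)) B  ≡⟨ cong sum (map-∘ B) ⟩
    total V (map (_∩ U L) B)     ≡⟨ total-filter big? V (map (_∩ U L) B) value<2 ⟨
    total V X                    ≤⟨ no-gain L X
                                      (All.tabulate X⊆𝒮 , AllPairs.filter⁺ big? (restrict-disjoint (U L) B-disjoint))
                                      (All.all-filter big? (map (_∩ U L) B)) touches⇒∈ w≤9 ⟩
    total V (members L)          ∎
    where
    open ≤-Reasoning
    X : Family n
    X = filter big? (map (_∩ U L) B)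
    X⊆𝒮 : ∀ {s} → s ∈ˡ X → s ∈ˡ 𝒮
    X⊆𝒮 s∈X with ∈-filter⁻ big? {xs = map (_∩ U L) B} s∈X
    ... | s∈ , 2≤∣s∣ with ∈-map⁻ (_∩ U L) s∈
    ...   | b , b∈B , refl = proj₂ inst b (All.lookup (proj₁ B-feasible) b∈B) (b ∩ U L)
                               (p∩q⊆p b (U L)) (0<∣-∣⇒Nonempty _ (≤-trans (s≤s z≤n) 2≤∣s∣))
    touches⇒∈ : ∀ {a} → a ∈ˡ A → Touches X a → a ∈ˡ L
    touches⇒∈ {a} a∈A t with find t
    ... | u , u∈X , x , x∈u∩a with ∈-map⁻ (_∩ U L) (proj₁ (∈-filter⁻ big? {xs = map (_∩ U L) B} u∈X))
    ...   | b , b∈B , refl with x∈p∩q⁻ (b ∩ U L) a x∈u∩a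
    ...     | x∈b∩U , x∈a = ∈U⁻ L (p∩q⊆q b (U L) x∈b∩U) a∈A x∈a

  -- Crediting value to the elements of removed sets

  α β : Fin n → Subset n
  α = owner A
  β = owner B

  φ : Fin n → ℕ
  φ x = ∣ β x ∩ F ∣

  σ : Subset n → ℕ
  σ a = ∑ a φ

  gain : Family n → Subset n → ℕ
  gain L b = fullValue ∣ b ∩ F ∣ ∣ b ∩ U L ∣

  φ-const : s ∈ˡ B → x ∈ s → φ x ≡ ∣ s ∩ F ∣
  φ-const s∈B x∈s = cong (λ b → ∣ b ∩ F ∣) (owner-unique B-disjoint s∈B x∈s)

  -- By `value-split`, a set `b` with free elements is worth at least `10 * φ x` for each of its
  -- elements `x` in removed sets. Regrouping these credits by the sets of `A` turns them into
  -- `10 * σ a`; elements outside `⋃ B` add nothing, as `φ` is 0 there.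
  gains : ∀ L → wF (members L) ≤ 9 →
          total (gain L) B + total (λ a → 10 * σ a) (members L) ≤ total V (members L)
  gains L w≤9 = begin
    total (gain L) B + total (λ a → 10 * σ a) (members L)
      ≡⟨ cong (total (gain L) B +_) (cong sum (map-cong (λ a → sym (∑-* a 10 φ)) (members L))) ⟩
    total (gain L) B + total (λ a → ∑ a 10φ) (members L)
      ≡⟨ cong (total (gain L) B +_) (total-∑ 10φ (AllPairs.filter⁺ (_∈ˡ? L) A-disjoint)) ⟩
    total (gain L) B + ∑ C 10φ
      ≤⟨ +-monoʳ-≤ _ (∑-mono C (⋃ (map (_∩ C) B)) cover) ⟩
    total (gain L) B + ∑ (⋃ (map (_∩ C) B)) 10φ
      ≡⟨ cong (total (gain L) B +_) (total-∑ 10φ (restrict-disjoint C B-disjoint)) ⟨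
    total (gain L) B + total (λ s → ∑ s 10φ) (map (_∩ C) B)
      ≡⟨ cong (total (gain L) B +_) (cong sum (map-∘ B)) ⟨
    total (gain L) B + total (λ b → ∑ (b ∩ C) 10φ) B
      ≡⟨ total-+ (gain L) (λ b → ∑ (b ∩ C) 10φ) B ⟨
    total (λ b → gain L b + ∑ (b ∩ C) 10φ) B
      ≤⟨ total-mono B pointwise ⟩
    total (λ b → V (b ∩ U L)) B
      ≤⟨ exchange L w≤9 ⟩
    total V (members L) ∎
    where
    open ≤-Reasoning
    10φ : Fin n → ℕ
    10φ x = 10 * φ x
    C : Subset n
    C = ⋃ (members L)
    cover : ∀ {x} → x ∈ C → 10φ x ≡ 0 ⊎ (x ∈ ⋃ (map (_∩ C) B) × 10φ x ≤ 10φ x)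
    cover {x} x∈C with x ∈? ⋃ B
    ... | yes x∈⋃B = let b∈B , x∈b = ∈-owner B x∈⋃B in
      inj₂ (∈⋃⁺ (∈-map⁺ (_∩ C) b∈B) (x∈p∩q⁺ (x∈b , x∈C)) , ≤-refl)
    ... | no x∉⋃B = inj₁ (cong (10 *_) (trans (cong (λ b → ∣ b ∩ F ∣) (owner-outside B x∉⋃B))
                                  (n≤0⇒n≡0 (≤-trans (∣p∩q∣≤∣p∣ ⊥ F) (≤-reflexive (∣⊥∣≡0 n))))))
    C⊆U : C ⊆ U L
    C⊆U x∈C with ∈⋃⁻ (members L) x∈C
    ... | a , a∈ , x∈a with ∈-filter⁻ (_∈ˡ? L) a∈
    ...   | a∈A , a∈L = ∈U⁺ L λ a′∈A x∈a′ →
      subst (_∈ˡ L) (trans (sym (owner-unique A-disjoint a∈A x∈a)) (owner-unique A-disjoint a′∈A x∈a′)) a∈L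
    C∩F : ∀ {x} → x ∈ C → x ∉ F
    C∩F x∈C x∈F with ∈⋃⁻ (members L) x∈C
    ... | a , a∈ , x∈a = x∈∁p⇒x∉p x∈F (∈⋃⁺ (proj₁ (∈-filter⁻ (_∈ˡ? L) {xs = A} a∈)) x∈a)
    pointwise : ∀ {b} → b ∈ˡ B → gain L b + ∑ (b ∩ C) 10φ ≤ V (b ∩ U L)
    pointwise {b} b∈B = begin
      gain L b + ∑ (b ∩ C) 10φ
        ≤⟨ +-monoʳ-≤ (gain L b) (∑-monoʳ (b ∩ C) λ x∈ →
             ≤-reflexive (cong (10 *_) (φ-const b∈B (p∩q⊆p b C x∈)))) ⟩
      gain L b + ∑ (b ∩ C) (λ _ → 10 * ∣ b ∩ F ∣)
        ≡⟨ cong (gain L b +_) (∑-const (b ∩ C) _) ⟩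
      gain L b + ∣ b ∩ C ∣ * (10 * ∣ b ∩ F ∣)
        ≤⟨ value-split ∣ b ∩ F ∣ ∣ b ∩ C ∣ parts (≤-trans (∣p∩q∣≤∣p∣ b (U L)) (B-size≤3 b∈B)) ⟩
      V (b ∩ U L) ∎
      where
      parts : ∣ b ∩ F ∣ + ∣ b ∩ C ∣ ≤ ∣ b ∩ U L ∣
      parts = ∣-∣-disjoint (b ∩ F) (b ∩ C) (b ∩ U L)
        (λ x∈ → let x∈b , x∈F = x∈p∩q⁻ b F x∈ in x∈p∩q⁺ (x∈b , F⊆U L x∈F))
        (λ x∈ → let x∈b , x∈C = x∈p∩q⁻ b C x∈ in x∈p∩q⁺ (x∈b , C⊆U x∈C))
        (λ (x , x∈) → let x∈bF , x∈bC = x∈p∩q⁻ (b ∩ F) (b ∩ C) x∈ in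
                      C∩F (p∩q⊆q b C x∈bC) (p∩q⊆q b F x∈bF))

  free≤1 : s ∈ˡ B → ∣ s ∩ F ∣ ≤ 1
  free≤1 {s} s∈B with ∣ s ∩ F ∣ ≤? 1
  ... | yes le = le
  ... | no ¬le = contradiction bound (<⇒≱ (value-pos (≰⇒> ¬le)))
    where
    open ≤-Reasoning
    value-pos : ∀ {k} → 2 ≤ k → 0 < value k
    value-pos (s≤s (s≤s _)) = z<s
    none : total V (members []) ≡ 0
    none = cong (total V) (filter-none (_∈ˡ? []) (All.universal (λ _ ()) A))
    none-w : wF (members []) ≡ 0
    none-w = cong wF (filter-none (_∈ˡ? []) (All.universal (λ _ ()) A))
    bound : V (s ∩ F) ≤ 0
    bound = begin
      V (s ∩ F)                    ≤⟨ value-mono (p⊆q⇒∣p∣≤∣q∣ λ x∈ →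
                                        let x∈s , x∈F = x∈p∩q⁻ s F x∈ in x∈p∩q⁺ (x∈s , F⊆U [] x∈F))
                                        (≤-trans (∣p∩q∣≤∣p∣ s (U [])) (B-size≤3 s∈B)) ⟩
      V (s ∩ U [])                 ≤⟨ total-∈ (λ b → V (b ∩ U [])) s∈B ⟩
      total (λ b → V (b ∩ U [])) B ≤⟨ exchange [] (subst (_≤ 9) (sym none-w) z≤n) ⟩
      total V (members [])         ≡⟨ none ⟩
      0                            ∎

  members≤ : ∀ f L → total f (members L) ≤ total f L
  members≤ f L = total-members f L A-unique

  -- Giving up `s` alone, `gains` yields `10 * σ s ≤ V s`.
  σ≤w : s ∈ˡ A → σ s ≤ w s
  σ≤w {s} s∈A = value-quotient ∣ s ∣ (begin
    10 * σ s                                         ≤⟨ total-∈ (λ a → 10 * σ a) s∈members ⟩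
    total (λ a → 10 * σ a) (members L)               ≤⟨ m≤n+m _ _ ⟩
    total (gain L) B + total (λ a → 10 * σ a) (members L) ≤⟨ gains L (≤-trans (members≤ w L) w≤9) ⟩
    total V (members L)                              ≤⟨ members≤ V L ⟩
    V s + 0                                          ≡⟨ +-identityʳ (V s) ⟩
    V s                                              ∎)
    where
    open ≤-Reasoning
    L : Family n
    L = s ∷ []
    s∈members : s ∈ˡ members L
    s∈members = ∈-filter⁺ (_∈ˡ? L) s∈A (here refl)
    w≤9 : wF L ≤ 9
    w≤9 = ≤-trans (≤-reflexive (+-identityʳ (w s))) (≤-trans (∸-monoˡ-≤ 1 (A-size≤3 s∈A)) (m≤m+n 2 7))

  -- The value of `a` left after the credits: 0 for tight, 10 for slack, and 21, 11, 1 for size 3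
  -- with `σ a` equal to 0, 1, 2. Truncation is harmless, as `gains≤δ` uses only
  -- `V a ≤ δ a + 10 * σ a`.
  δ : Subset n → ℕ
  δ a = V a ∸ 10 * σ a

  -- Cancelling the credits on both sides leaves the form in which all exclusions below are proved:
  -- a list `L` of sets to remove, and sets of `B` whose gains exceed the sum of `δ` over `L`.
  gains≤δ : ∀ L → wF L ≤ 9 → total (gain L) B ≤ total δ L
  gains≤δ L w≤9 = ≤-trans (+-cancelʳ-≤ (total (λ a → 10 * σ a) (members L)) _ _ (begin
    total (gain L) B + total (λ a → 10 * σ a) (members L) ≤⟨ gains L (≤-trans (members≤ w L) w≤9) ⟩
    total V (members L)                                   ≤⟨ total-mono (members L) (λ {a} _ → split (V a) (10 * σ a)) ⟩
    total (λ a → δ a + 10 * σ a) (members L)              ≡⟨ total-+ δ (λ a → 10 * σ a) (members L) ⟩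
    total δ (members L) + total (λ a → 10 * σ a) (members L) ∎)) (members≤ δ L)
    where
    open ≤-Reasoning
    split : ∀ v k → v ≤ (v ∸ k) + k
    split v k = ≤-trans (m≤n+m∸n v k) (≤-reflexive (+-comm k (v ∸ k)))

  covered : s ∈ˡ B → ∣ s ∩ F ∣ ≡ 0 → x ∈ s → x ∈ ⋃ A
  covered {s} s∈B full x∈s = x∉∁p⇒x∈p λ x∈F → ∣-∣≡0⇒∉ (s ∩ F) full (x∈p∩q⁺ (x∈s , x∈F))

  α∈A : x ∈ ⋃ A → α x ∈ˡ A
  α∈A = proj₁ ∘ ∈-owner A

  w-α≤2 : x ∈ ⋃ A → w (α x) ≤ 2
  w-α≤2 x∈ = ∸-monoˡ-≤ 1 (A-size≤3 (α∈A x∈))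

  ∈U-α : ∀ L → α x ∈ˡ L → x ∈ U L
  ∈U-α L αx∈L = ∈U⁺ L λ a∈A x∈a → subst (_∈ˡ L) (owner-unique A-disjoint a∈A x∈a) αx∈L

  gain-full : ∀ L → s ∈ˡ B → ∣ s ∩ F ∣ ≡ 0 → ∀ {k} → k ≤ ∣ s ∩ U L ∣ → value k ≤ gain L s
  gain-full {s} L s∈B full k≤ rewrite full = value-mono k≤ (≤-trans (∣p∩q∣≤∣p∣ s (U L)) (B-size≤3 s∈B))

  gain-pair : ∀ L → s ∈ˡ B → ∣ s ∩ F ∣ ≡ 0 → x ∈ s → y ∈ s → x ≢ y →
              α x ∈ˡ L → α y ∈ˡ L → 10 ≤ gain L s
  gain-pair L s∈B full x∈s y∈s x≢y αx∈L αy∈L = gain-full L s∈B full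
    (2≤∣-∣ (x∈p∩q⁺ (x∈s , ∈U-α L αx∈L)) (x∈p∩q⁺ (y∈s , ∈U-α L αy∈L)) x≢y)

  gain-triple : ∀ L → s ∈ˡ B → ∣ s ∩ F ∣ ≡ 0 → x ∈ s → y ∈ s → z ∈ s → x ≢ y → x ≢ z → y ≢ z →
                α x ∈ˡ L → α y ∈ˡ L → α z ∈ˡ L → 21 ≤ gain L s
  gain-triple L s∈B full x∈s y∈s z∈s x≢y x≢z y≢z αx∈L αy∈L αz∈L = gain-full L s∈B full
    (3≤∣-∣ (x∈p∩q⁺ (x∈s , ∈U-α L αx∈L)) (x∈p∩q⁺ (y∈s , ∈U-α L αy∈L)) (x∈p∩q⁺ (z∈s , ∈U-α L αz∈L))
           x≢y x≢z y≢z)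

  -- Excluded configurations

  HasType : ℕ → ℕ → Fin n → Set
  HasType m k x = ∣ α x ∣ ≡ m × σ (α x) ≡ k

  Tight Slack : Fin n → Set
  Tight = HasType 2 1
  Slack = HasType 2 0

  hasType? : ∀ m k x → Dec (HasType m k x)
  hasType? m k x = (∣ α x ∣ ≟ m) ×-dec (σ (α x) ≟ k)

  δ-type : ∀ {m k} → HasType m k x → δ (α x) ≡ value m ∸ 10 * k
  δ-type (p , q) = cong₂ (λ m k → value m ∸ 10 * k) p q

  w-type : ∀ {m k} → HasType m k x → w (α x) ≡ m ∸ 1
  w-type (p , _) = cong (_∸ 1) p

  type-≢ : ∀ {m k m′ k′} → HasType m k x → HasType m′ k′ y → (m , k) ≢ (m′ , k′) → x ≢ y
  type-≢ (p , q) (p′ , q′) ne refl = ne (cong₂ _,_ (trans (sym p) p′) (trans (sym q) q′))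

  size-≢ : ∣ α x ∣ ≡ 3 → ∣ α y ∣ ≡ 2 → x ≢ y
  size-≢ p q refl = contradiction (trans (sym p) q) λ ()

  -- Removing the owners of `x` and `y` frees two elements of `s`, worth 10. Beside a tight element,
  -- with deficit 0, this rules out another tight one and one of type (3, 2), with deficits 0 and 1.
  pair-deficit : ∀ {m k m′ k′} → s ∈ˡ B → ∣ s ∩ F ∣ ≡ 0 → x ∈ s → y ∈ s → x ≢ y →
                 HasType m k x → HasType m′ k′ y → 10 ≤ (value m ∸ 10 * k) + (value m′ ∸ 10 * k′)
  pair-deficit {s} {x} {y} {m} {k} {m′} {k′} s∈B full x∈s y∈s x≢y x-type y-type = begin
    10                          ≤⟨ gain-pair L s∈B full x∈s y∈s x≢y (here refl) (there (here refl)) ⟩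
    gain L s                    ≤⟨ total-∈ (gain L) s∈B ⟩
    total (gain L) B            ≤⟨ gains≤δ L w≤9 ⟩
    δ (α x) + (δ (α y) + 0)     ≡⟨ cong₂ _+_ (δ-type x-type) (trans (+-identityʳ _) (δ-type y-type)) ⟩
    (value m ∸ 10 * k) + (value m′ ∸ 10 * k′) ∎
    where
    open ≤-Reasoning
    L : Family n
    L = α x ∷ α y ∷ []
    w≤9 : wF L ≤ 9
    w≤9 = ≤-trans (+-mono-≤ (w-α≤2 (covered s∈B full x∈s)) (+-monoˡ-≤ 0 (w-α≤2 (covered s∈B full y∈s)))) (m≤m+n 4 5)

  -- The gain is 21 and the deficits are 0, 10 and 10. In weight this is a tie, and the bonus for a
  -- set of weight 2 decides it.
  tight-slack-slack : s ∈ˡ B → ∣ s ∩ F ∣ ≡ 0 → x ∈ s → y ∈ s → z ∈ s → x ≢ y → x ≢ z → y ≢ z →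
                      Tight x → Slack y → ¬ Slack z
  tight-slack-slack {s} {x} {y} {z} s∈B full x∈s y∈s z∈s x≢y x≢z y≢z x-tight y-slack z-slack =
    contradiction (begin
      21               ≤⟨ gain-triple L s∈B full x∈s y∈s z∈s x≢y x≢z y≢z
                            (here refl) (there (here refl)) (there (there (here refl))) ⟩
      gain L s         ≤⟨ total-∈ (gain L) s∈B ⟩
      total (gain L) B ≤⟨ gains≤δ L w≤9 ⟩
      total δ L        ≡⟨ cong₂ _+_ (δ-type x-tight) (cong₂ _+_ (δ-type y-slack) (cong (_+ 0) (δ-type z-slack))) ⟩
      20               ∎) (<⇒≱ (n<1+n 20))
    where
    open ≤-Reasoning
    L : Family n
    L = α x ∷ α y ∷ α z ∷ []
    w≤9 : wF L ≤ 9
    w≤9 = ≤-trans (≤-reflexive (cong₂ _+_ (w-type x-tight) (cong₂ _+_ (w-type y-slack)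
            (cong (_+ 0) (w-type z-slack))))) (m≤m+n 3 6)

  -- For ∣ α x ∣ ≡ 3: the tight and the slack element of β x together can afford only 2 + 4
  -- of the 12 sixths that β x needs, so x is charged 6.
  Heavy : Fin n → Set
  Heavy x = φ x ≡ 0 × (∃[ y ] y ∈ β x × Tight y) × (∃[ z ] z ∈ β x × Slack z)

  heavy? : ∀ x → Dec (Heavy x)
  heavy? x = (φ x ≟ 0) ×-dec Fin.any? (λ y → (y ∈? β x) ×-dec hasType? 2 1 y)
                       ×-dec Fin.any? (λ z → (z ∈? β x) ×-dec hasType? 2 0 z)

  heavy-∈⋃B : Heavy x → x ∈ ⋃ B
  heavy-∈⋃B {x} (_ , (y , y∈ , _) , _) with x ∈? ⋃ B
  ... | yes x∈ = x∈
  ... | no x∉  = contradiction (subst (y ∈_) (owner-outside B x∉) y∈) ∉⊥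

  -- Otherwise s would have four elements.
  crowded : s ∈ˡ B → x ∈ s → y ∈ s → x ≢ y → ∣ α x ∣ ≡ 3 → ∣ α y ∣ ≡ 3 →
            (∃[ u ] u ∈ s × Tight u) → ¬ (∃[ v ] v ∈ s × Slack v)
  crowded {s} {x} {y} s∈B x∈s y∈s x≢y x3 y3 (u , u∈s , u-tight) (v , v∈s , v-slack) =
    contradiction (B-size≤3 s∈B) (<⇒≱ (subst (4 ≤_) (∣-∣-remove x∈s) (s≤s
      (3≤∣-∣ (rest y∈s x≢y) (rest u∈s (size-≢ x3 (proj₁ u-tight))) (rest v∈s (size-≢ x3 (proj₁ v-slack)))
             (size-≢ y3 (proj₁ u-tight)) (size-≢ y3 (proj₁ v-slack)) (type-≢ u-tight v-slack λ ())))))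
    where
    rest : ∀ {z} → z ∈ s → x ≢ z → z ∈ s - x
    rest z∈s x≢z = x∈p∧x≢y⇒x∈p-y z∈s (x≢z ∘ sym)

  heavy-gain : ∀ L → (h : Heavy x) → ∣ α x ∣ ≡ 3 → let (_ , (y , _) , (z , _)) = h in
               α x ∈ˡ L → α y ∈ˡ L → α z ∈ˡ L → 21 ≤ gain L (β x)
  heavy-gain L h@(full , (y , y∈ , y-tight) , (z , z∈ , z-slack)) x3 αx∈L αy∈L αz∈L =
    let b∈B , x∈b = ∈-owner B (heavy-∈⋃B h) in
    gain-triple L b∈B full x∈b y∈ z∈ (size-≢ x3 (proj₁ y-tight)) (size-≢ x3 (proj₁ z-slack))
                (type-≢ y-tight z-slack λ ()) αx∈L αy∈L αz∈L

  -- Remove the common owner of `x` and `y` together with the tight and slack sets of both. Two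
  -- different sets of `B` then gain 21 each, 42 in total, while the deficits sum to at most 21 + 10
  -- + 10 = 41; again only the bonus decides. The two sets differ by `crowded`.
  heavy-unique : α x ≡ α y → x ≢ y → ∣ α x ∣ ≡ 3 → Heavy x → ¬ Heavy y
  heavy-unique {x} {y} αx≡αy x≢y x3
    hx@(_ , (u , u∈ , u-tight) , (v , v∈ , v-slack))
    hy@(_ , (u′ , u′∈ , u′-tight) , (v′ , v′∈ , v′-slack)) =
    contradiction (begin
      42                          ≤⟨ +-mono-≤
        (heavy-gain L hx x3 (here refl) (there (here refl)) (there (there (here refl))))
        (heavy-gain L hy y3 (here (sym αx≡αy)) (there (there (there (here refl))))
                                               (there (there (there (there (here refl)))))) ⟩
      gain L (β x) + gain L (β y) ≤⟨ total-pair (gain L) βx∈B βy∈B βx≢βy ⟩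
      total (gain L) B            ≤⟨ gains≤δ L w≤9 ⟩
      total δ L                   ≡⟨ cong (δ (α x) +_) (cong₂ _+_ (δ-type u-tight) (cong₂ _+_ (δ-type v-slack)
                                       (cong₂ _+_ (δ-type u′-tight) (cong (_+ 0) (δ-type v′-slack))))) ⟩
      δ (α x) + 20                ≤⟨ +-monoˡ-≤ 20 (≤-trans (m∸n≤m (V (α x)) (10 * σ (α x)))
                                                           (≤-reflexive (cong value x3))) ⟩
      41                          ∎) (<⇒≱ (n<1+n 41))
    where
    open ≤-Reasoning
    L : Family n
    L = α x ∷ α u ∷ α v ∷ α u′ ∷ α v′ ∷ []
    y3 : ∣ α y ∣ ≡ 3
    y3 = trans (cong ∣_∣ (sym αx≡αy)) x3
    βx∈B : β x ∈ˡ B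
    βx∈B = proj₁ (∈-owner B (heavy-∈⋃B hx))
    βy∈B : β y ∈ˡ B
    βy∈B = proj₁ (∈-owner B (heavy-∈⋃B hy))
    y∈βy : y ∈ β y
    y∈βy = proj₂ (∈-owner B (heavy-∈⋃B hy))
    βx≢βy : β x ≢ β y
    βx≢βy eq = crowded βx∈B (proj₂ (∈-owner B (heavy-∈⋃B hx))) (subst (y ∈_) (sym eq) y∈βy) x≢y x3 y3
                 (u , u∈ , u-tight) (v , v∈ , v-slack)
    w≤9 : wF L ≤ 9
    w≤9 = ≤-trans (≤-reflexive (cong₂ _+_ (cong (_∸ 1) x3) (cong₂ _+_ (w-type u-tight) (cong₂ _+_ (w-type v-slack)
            (cong₂ _+_ (w-type u′-tight) (cong (_+ 0) (w-type v′-slack))))))) (m≤m+n 6 3)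

  -- Remove the owners of `x` and `y` and those of the tight and slack elements beside `z`. Then
  -- `β z` gains 21 and the pair in `s` gains 10, against deficits 0 + 11 + 0 + 10. By `crowded`,
  -- `β z` is not `s`.
  tight-not-next-to-light : s ∈ˡ B → ∣ s ∩ F ∣ ≡ 0 → x ∈ s → y ∈ s → Tight x → HasType 3 1 y →
                            y ≢ z → α z ≡ α y → ¬ Heavy z
  tight-not-next-to-light {s} {x} {y} {z} s∈B full x∈s y∈s x-tight y-31 y≢z αz≡αy
    hz@(_ , (u , u∈ , u-tight) , (v , v∈ , v-slack)) =
    contradiction (begin
      31                         ≤⟨ +-mono-≤
        (heavy-gain L hz z3 (there (here αz≡αy)) (there (there (here refl))) (there (there (there (here refl)))))
        (gain-pair L s∈B full x∈s y∈s (size-≢ (proj₁ y-31) (proj₁ x-tight) ∘ sym) (here refl) (there (here refl))) ⟩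
      gain L (β z) + gain L s    ≤⟨ total-pair (gain L) βz∈B s∈B βz≢s ⟩
      total (gain L) B           ≤⟨ gains≤δ L w≤9 ⟩
      total δ L                  ≡⟨ cong₂ _+_ (δ-type x-tight) (cong₂ _+_ (δ-type y-31)
                                      (cong₂ _+_ (δ-type u-tight) (cong (_+ 0) (δ-type v-slack)))) ⟩
      21                         ∎) (<⇒≱ (m≤m+n 22 9))
    where
    open ≤-Reasoning
    L : Family n
    L = α x ∷ α y ∷ α u ∷ α v ∷ []
    z3 : ∣ α z ∣ ≡ 3
    z3 = trans (cong ∣_∣ αz≡αy) (proj₁ y-31)
    βz∈B : β z ∈ˡ B
    βz∈B = proj₁ (∈-owner B (heavy-∈⋃B hz))
    βz≢s : β z ≢ s
    βz≢s eq = crowded βz∈B (proj₂ (∈-owner B (heavy-∈⋃B hz))) (subst (y ∈_) (sym eq) y∈s) (y≢z ∘ sym) z3 (proj₁ y-31)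
                (u , u∈ , u-tight) (v , v∈ , v-slack)
    w≤9 : wF L ≤ 9
    w≤9 = ≤-trans (≤-reflexive (cong₂ _+_ (w-type x-tight) (cong₂ _+_ (w-type y-31)
            (cong₂ _+_ (w-type u-tight) (cong (_+ 0) (w-type v-slack)))))) (m≤m+n 5 4)

  -- The charge and its bounds on both sides

  h : Fin n → ℕ
  h x = indicator (heavy? x)

  h-heavy : Heavy x → h x ≡ 1
  h-heavy {x} = indicator-yes (heavy? x)

  heavy-h : 0 < h x → Heavy x
  heavy-h {x} = indicator-pos (heavy? x)

  h≤1 : ∀ x → h x ≤ 1
  h≤1 x = indicator≤1 (heavy? x)

  η : Subset n → ℕ
  η a = ∑ a h

  η≤1 : s ∈ˡ A → ∣ s ∣ ≡ 3 → η s ≤ 1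
  η≤1 {s} s∈A s3 with η s ≤? 1
  ... | yes le = le
  ... | no ¬le with ∑-pos s h (≤-trans z<s (≰⇒> ¬le))
  ...   | x , x∈s , 0<hx with ∑-pos (s - x) h (+-cancelˡ-≤ 1 _ _ (begin
            2                    ≤⟨ ≰⇒> ¬le ⟩
            η s                  ≡⟨ ∑-remove h x∈s ⟨
            h x + ∑ (s - x) h    ≤⟨ +-monoˡ-≤ _ (h≤1 x) ⟩
            1 + ∑ (s - x) h      ∎))
    where open ≤-Reasoning
  ...     | y , y∈ , 0<hy =
    let y∈s , x≢y = ∈-remove⁻ s y∈
        αx≡s      = owner-unique A-disjoint s∈A x∈s
        αy≡s      = owner-unique A-disjoint s∈A y∈s
    in contradiction (heavy-h 0<hy)
         (heavy-unique (trans αx≡s (sym αy≡s)) x≢y (trans (cong ∣_∣ αx≡s) s3) (heavy-h 0<hx))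

  c : Fin n → ℕ
  c x = rate (coefficients ∣ α x ∣ (σ (α x)) (η (α x))) (φ x) (h x)

  c-outside : x ∉ ⋃ A → c x ≡ 0
  c-outside {x} x∉ rewrite owner-outside A x∉ | ∣⊥∣≡0 n = refl

  -- The coefficients are constant on `s` and the rate is affine, so the sum depends only on
  -- `∣ s ∣`, `σ s` and `η s`, and `budget` applies.
  A-charge : s ∈ˡ A → ∑ s c ≤ 8 * w s
  A-charge {s} s∈A = begin
    ∑ s c
      ≤⟨ ∑-monoʳ s (λ x∈s → ≤-reflexive (cong (λ a → rate (coefficients ∣ a ∣ (σ a) (η a)) _ _)
                                              (owner-unique A-disjoint s∈A x∈s))) ⟩
    ∑ s (λ x → p + (q * φ x + r * h x))
      ≡⟨ ∑-+ s (λ _ → p) _ ⟩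
    ∑ s (λ _ → p) + ∑ s (λ x → q * φ x + r * h x)
      ≡⟨ cong₂ _+_ (∑-const s p) (trans (∑-+ s _ _) (cong₂ _+_ (∑-* s q φ) (∑-* s r h))) ⟩
    ∣ s ∣ * p + (q * σ s + r * η s)
      ≤⟨ budget ∣ s ∣ (σ s) (η s) (All.lookup A-big s∈A) (A-size≤3 s∈A) (σ≤w s∈A) (η≤1 s∈A) ⟩
    8 * w s ∎
    where
    open ≤-Reasoning
    p q r : ℕ
    p = proj₁ (coefficients ∣ s ∣ (σ s) (η s))
    q = proj₁ (proj₂ (coefficients ∣ s ∣ (σ s) (η s)))
    r = proj₂ (proj₂ (coefficients ∣ s ∣ (σ s) (η s)))

  data Kind (x : Fin n) : Set where
    tight : Tight x → Kind x
    slack : Slack x → Kind x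
    big   : ∀ k → HasType 3 k x → k ≤ 2 → Kind x

  kind : x ∈ ⋃ A → Kind x
  kind {x} x∈ = go (∣ α x ∣) (σ (α x)) refl refl (All.lookup A-big (α∈A x∈)) (A-size≤3 (α∈A x∈)) (σ≤w (α∈A x∈))
    where
    go : ∀ m k → ∣ α x ∣ ≡ m → σ (α x) ≡ k → 2 ≤ m → m ≤ 3 → k ≤ m ∸ 1 → Kind x
    go 2 0 p q _ _ _ = slack (p , q)
    go 2 1 p q _ _ _ = tight (p , q)
    go 2 (suc (suc _)) p q _ _ (s≤s ())
    go 3 k p q _ _ k≤2 = big k (p , q) k≤2
    go 1 _ _ _ (s≤s ()) _ _
    go (suc (suc (suc (suc m)))) _ _ _ _ (s≤s (s≤s (s≤s ()))) _

  c-type : ∀ {m k} → HasType m k x → c x ≡ rate (coefficients m k (η (α x))) (φ x) (h x)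
  c-type {x} (p , q) = cong₂ (λ m k → rate (coefficients m k (η (α x))) (φ x) (h x)) p q

  c≥6 : x ∈ ⋃ A → φ x ≡ 1 → 6 ≤ c x
  c≥6 {x} x∈ φx≡1 = subst (λ f → 6 ≤ rate (coefficients ∣ α x ∣ (σ (α x)) (η (α x))) f (h x)) (sym φx≡1)
    (rate≥6 ∣ α x ∣ (σ (α x)) (η (α x)) (h x) (All.lookup A-big (α∈A x∈)) (A-size≤3 (α∈A x∈)))

  c-tight : Tight x → 2 ≤ c x
  c-tight t = ≤-trans (m≤m+n 2 _) (≤-reflexive (sym (c-type t)))

  c≥4 : x ∈ ⋃ A → ¬ Tight x → 4 ≤ c x
  c≥4 {x} x∈ ¬tight = rate≥4 ∣ α x ∣ (σ (α x)) (η (α x)) (φ x) (h x)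
    (All.lookup A-big (α∈A x∈)) (A-size≤3 (α∈A x∈)) (σ≤w (α∈A x∈)) ¬tight

  -- The elements that can accompany a tight one in a set without free elements. The bound 6 is
  -- conditional because heaviness also depends on whether that set has a slack element.
  data Companion (y : Fin n) : Set where
    slack : Slack y → 4 ≤ c y → Companion y
    big   : ∣ α y ∣ ≡ 3 → 5 ≤ c y → (Heavy y → 6 ≤ c y) → Companion y

  companion : s ∈ˡ B → ∣ s ∩ F ∣ ≡ 0 → x ∈ s → y ∈ s → x ≢ y → Tight x → Companion y
  companion {s} {x} {y} s∈B full x∈s y∈s x≢y x-tight with kind (covered s∈B full y∈s)
  ... | tight t = contradiction (pair-deficit s∈B full x∈s y∈s x≢y x-tight t) λ ()
  ... | big 2 t _ = contradiction (pair-deficit s∈B full x∈s y∈s x≢y x-tight t) λ { (s≤s ()) }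
  ... | slack t = slack t (c≥4 (covered s∈B full y∈s) λ t′ → contradiction (trans (sym (proj₂ t)) (proj₂ t′)) λ ())
  ... | big (suc (suc (suc _))) t (s≤s (s≤s ()))
  ... | big 0 t _ = big (proj₁ t)
    (≤-trans (m≤m+n 5 _) (≤-reflexive (sym (c-type t))))
    λ hy → ≤-trans (rate-3-0 {η (α y)} (φ y) (h-heavy hy)) (≤-reflexive (sym (c-type t)))
  -- For type (3, 1) the charge falls to 4 only if `y` is not heavy but another element of its set
  -- is, which `tight-not-next-to-light` excludes.
  ... | big 1 t _ = companion-3-1 (heavy? y)
    where
    light : ¬ Heavy y → η (α y) ≡ 0
    light ¬hy = n<1⇒n≡0 (≰⇒> λ 0<η → let z , z∈ , 0<hz = ∑-pos (α y) h 0<η in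
      tight-not-next-to-light s∈B full x∈s y∈s x-tight t
        (λ y≡z → ¬hy (subst Heavy (sym y≡z) (heavy-h 0<hz)))
        (owner-unique A-disjoint (α∈A (covered s∈B full y∈s)) z∈) (heavy-h 0<hz))
    companion-3-1 : Dec (Heavy y) → Companion y
    companion-3-1 (yes hy) = big (proj₁ t) (≤-trans (n≤1+n 5) c≥) λ _ → c≥
      where
      η>0 : 0 < η (α y)
      η>0 = subst (0 <_) (∑-remove h (proj₂ (∈-owner A (covered s∈B full y∈s))))
              (≤-trans (≤-reflexive (sym (h-heavy hy))) (m≤m+n (h y) _))
      c≥ : 6 ≤ c y
      c≥ = ≤-trans (rate-3-1 (φ y) η>0 (h-heavy hy)) (≤-reflexive (sym (c-type t)))
    companion-3-1 (no ¬hy) = big (proj₁ t)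
      (≤-trans (m≤m+n 5 _) (≤-reflexive (sym (trans (c-type t)
        (cong (λ e → rate (coefficients 3 1 e) (φ y) (h y)) (light ¬hy))))))
      λ hy → contradiction hy ¬hy

  -- With one free element, each of the others has `φ = 1` and pays 6. With no free and no tight
  -- element each pays at least 4, and `6 * (k ∸ 1) ≤ k * 4` for `k ≤ 3`. A tight element pays 2, so
  -- its companions must pay 4 if there is one and 10 if there are two.
  B-charge : s ∈ˡ B → 6 * w s ≤ ∑ s c
  B-charge {s} s∈B with ∣ s ∩ F ∣ in free | free≤1 s∈B
  ... | suc (suc _) | s≤s ()
  ... | 1 | _ = begin
    6 * w s                        ≡⟨ cong (λ k → 6 * (k ∸ 1)) (∣-∣-remove u∈s) ⟨
    6 * ∣ s - u ∣                  ≡⟨ trans (∑-const (s - u) 6) (*-comm ∣ s - u ∣ 6) ⟨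
    ∑ (s - u) (λ _ → 6)            ≤⟨ ∑-monoʳ (s - u) (λ y∈ → let y∈s , u≢y = ∈-remove⁻ s y∈ in
                                        c≥6 (x∉∁p⇒x∈p (other y∈s u≢y)) (trans (φ-const s∈B y∈s) free)) ⟩
    ∑ (s - u) c                    ≤⟨ m≤n+m _ (c u) ⟩
    c u + ∑ (s - u) c              ≡⟨ ∑-remove c u∈s ⟩
    ∑ s c                          ∎
    where
    open ≤-Reasoning
    witness : Nonempty (s ∩ F)
    witness = 0<∣-∣⇒Nonempty (s ∩ F) (subst (0 <_) (sym free) z<s)
    u : Fin n
    u = proj₁ witness
    u∈s : u ∈ s
    u∈s = p∩q⊆p s F (proj₂ witness)
    other : ∀ {y} → y ∈ s → u ≢ y → y ∉ F
    other y∈s u≢y y∈F = <⇒≱ (2≤∣-∣ (proj₂ witness) (x∈p∩q⁺ (y∈s , y∈F)) u≢y) (≤-reflexive free)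
  ... | 0 | _ with Fin.any? (λ x → (x ∈? s) ×-dec hasType? 2 1 x)
  ...   | no none = begin
    6 * w s        ≤⟨ no-tight ∣ s ∣ (B-size≤3 s∈B) ⟩
    ∣ s ∣ * 4      ≡⟨ ∑-const s 4 ⟨
    ∑ s (λ _ → 4)  ≤⟨ ∑-monoʳ s (λ x∈s → c≥4 (covered s∈B free x∈s) λ t → none (_ , x∈s , t)) ⟩
    ∑ s c          ∎
    where
    open ≤-Reasoning
    no-tight : ∀ k → k ≤ 3 → 6 * (k ∸ 1) ≤ k * 4
    no-tight 0 _ = z≤n
    no-tight 1 _ = z≤n
    no-tight 2 _ = m≤m+n 6 2
    no-tight 3 _ = ≤-refl
    no-tight (suc (suc (suc (suc k)))) (s≤s (s≤s (s≤s ())))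
  ...   | yes (x , x∈s , x-tight) = begin
    6 * w s             ≡⟨ cong (λ k → 6 * (k ∸ 1)) (∣-∣-remove x∈s) ⟨
    6 * ∣ s - x ∣       ≤⟨ others ∣ s - x ∣ refl (s≤s⁻¹ (≤-trans (≤-reflexive (∣-∣-remove x∈s)) (B-size≤3 s∈B))) ⟩
    c x + ∑ (s - x) c   ≡⟨ ∑-remove c x∈s ⟩
    ∑ s c               ∎
    where
    open ≤-Reasoning
    company : ∀ {y} → y ∈ s - x → Companion y
    company y∈ = let y∈s , x≢y = ∈-remove⁻ s y∈ in companion s∈B free x∈s y∈s x≢y x-tight
    companion≥4 : ∀ {y} → Companion y → 4 ≤ c y
    companion≥4 (slack _ p) = p
    companion≥4 (big _ p _) = ≤-trans (n≤1+n 4) p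
    heavy : ∀ {y z} → y ∈ s → z ∈ s → Slack z → Heavy y
    heavy {y} {z} y∈s z∈s z-slack = trans (φ-const s∈B y∈s) free ,
      (x , subst (x ∈_) (sym βy≡s) x∈s , x-tight) , (z , subst (z ∈_) (sym βy≡s) z∈s , z-slack)
      where
      βy≡s : β y ≡ s
      βy≡s = owner-unique B-disjoint s∈B y∈s
    -- Two slack companions are impossible, a slack one makes the other heavy (4 + 6), and two of
    -- size 3 pay 5 + 5.
    two : ∀ {y z} → y ∈ s → z ∈ s → x ≢ y → x ≢ z → y ≢ z → Companion y → Companion z → 10 ≤ c y + c z
    two y∈s z∈s x≢y x≢z y≢z (slack y-slack p) (slack z-slack q) =
      contradiction z-slack (tight-slack-slack s∈B free x∈s y∈s z∈s x≢y x≢z y≢z x-tight y-slack)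
    two y∈s z∈s _ _ _ (slack y-slack p) (big _ _ q) = +-mono-≤ p (q (heavy z∈s y∈s y-slack))
    two y∈s z∈s _ _ _ (big _ _ p) (slack z-slack q) = +-mono-≤ (p (heavy y∈s z∈s z-slack)) q
    two _ _ _ _ _ (big _ p _) (big _ q _) = +-mono-≤ p q
    others : ∀ k → ∣ s - x ∣ ≡ k → k ≤ 2 → 6 * k ≤ c x + ∑ (s - x) c
    others 0 _ _ = z≤n
    others 1 size _ = +-mono-≤ (c-tight x-tight)
      (≤-trans (companion≥4 (company y∈)) (≤-trans (m≤m+n _ _) (≤-reflexive (∑-remove c y∈))))
      where
      y∈ = proj₂ (0<∣-∣⇒Nonempty (s - x) (subst (0 <_) (sym size) z<s))
    others 2 size _ = +-mono-≤ (c-tight x-tight)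
      (≤-trans (two y∈s z∈s x≢y x≢z y≢z (company y∈) (company z∈)) (∑-pair c y∈ z∈ y≢z))
      where
      y-witness = 0<∣-∣⇒Nonempty (s - x) (subst (0 <_) (sym size) z<s)
      y∈ = proj₂ y-witness
      z-witness = 0<∣-∣⇒Nonempty (s - x - proj₁ y-witness)
        (s≤s⁻¹ (subst (2 ≤_) (sym (trans (∣-∣-remove y∈) size)) ≤-refl))
      z∈ = proj₁ (∈-remove⁻ (s - x) (proj₂ z-witness))
      y≢z = proj₂ (∈-remove⁻ (s - x) (proj₂ z-witness))
      y∈s = proj₁ (∈-remove⁻ s y∈)
      x≢y = proj₂ (∈-remove⁻ s y∈)
      z∈s = proj₁ (∈-remove⁻ s z∈)
      x≢z = proj₂ (∈-remove⁻ s z∈)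
    others (suc (suc (suc k))) _ (s≤s (s≤s ()))

  -- The total charge is at least `6 * wF B` when summed over `⋃ B` and at most `8 * wF A` when
  -- summed over `⋃ A`, outside of which it is 0.
  bound : 3 * wF B ≤ 4 * wF A
  bound = *-cancelˡ-≤ 2 (begin
    2 * (3 * wF B)          ≡⟨ *-assoc 2 3 (wF B) ⟨
    6 * wF B                ≡⟨ total-* 6 w B ⟨
    total (λ b → 6 * w b) B ≤⟨ total-mono B B-charge ⟩
    total (λ b → ∑ b c) B   ≡⟨ total-∑ c B-disjoint ⟩
    ∑ (⋃ B) c               ≤⟨ ∑-mono (⋃ B) (⋃ A) inside-A ⟩
    ∑ (⋃ A) c               ≡⟨ total-∑ c A-disjoint ⟨
    total (λ a → ∑ a c) A   ≤⟨ total-mono A A-charge ⟩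
    total (λ a → 8 * w a) A ≡⟨ total-* 8 w A ⟩
    8 * wF A                ≡⟨ *-assoc 2 4 (wF A) ⟩
    2 * (4 * wF A)          ∎)
    where
    open ≤-Reasoning
    inside-A : ∀ {x} → x ∈ ⋃ B → c x ≡ 0 ⊎ (x ∈ ⋃ A × c x ≤ c x)
    inside-A {x} _ with x ∈? ⋃ A
    ... | yes x∈ = inj₂ (x∈ , ≤-refl)
    ... | no x∉  = inj₁ (c-outside x∉)

-- Discarding the sets of weight 0

filter-comm : ∀ {P Q : Subset n → Set} (P? : ∀ s → Dec (P s)) (Q? : ∀ s → Dec (Q s)) Y →
              filter P? (filter Q? Y) ≡ filter Q? (filter P? Y)
filter-comm P? Q? []      = refl
filter-comm P? Q? (s ∷ Y) with does (P? s) in p | does (Q? s) in q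
... | false | false = filter-comm P? Q? Y
... | true  | false rewrite q = filter-comm P? Q? Y
... | false | true  rewrite p = filter-comm P? Q? Y
... | true  | true  rewrite p | q = cong (s ∷_) (filter-comm P? Q? Y)

-- Small sets can be discarded after taking the neighborhood instead of before, and there they add
-- nothing. With `f` the weight or the bonus, this carries local optimality from `A` over to `A⁺`.
total-N-big : ∀ (f : Subset n → ℕ) X A → (∀ {s} → ¬ 2 ≤ ∣ s ∣ → f s ≡ 0) →
              total f (N X (filter big? A)) ≡ total f (N X A)
total-N-big f X A f≡0 = trans (cong (total f) (filter-comm touches? big? A)) (total-filter big? f (N X A) f≡0)
  where
  touches? : ∀ a → Dec (Any (λ u → Nonempty (u ∩ a)) X)
  touches? a = any? (λ u → nonempty? (u ∩ a)) X

theorem5 : ∀ (n : ℕ) (𝒮 A B : Family n) → IsInstance 𝒮 → Feasible 𝒮 A →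
    (∀ X → length X ≤ 10 → ¬ LocalImprovement 𝒮 A X) → Optimum 𝒮 B →
    3 * wF B ≤ 4 * wF A
theorem5 n 𝒮 A B inst (A⊆𝒮 , A-disjoint) no-improvement (B-feasible , _) =
  subst (λ k → 3 * wF B ≤ 4 * k) (total-filter big? w A λ {s} → w≡0 ∣ s ∣)
    (LocalOptimum.bound inst (All.filter⁺ big? A⊆𝒮 , AllPairs.filter⁺ big? A-disjoint)
      (All.all-filter big? A) B-feasible no-improvement′)
  where
  A⁺ : Family n
  A⁺ = filter big? A
  w≡0 : ∀ k → ¬ 2 ≤ k → k ∸ 1 ≡ 0
  w≡0 0 _ = refl
  w≡0 1 _ = refl
  w≡0 (suc (suc k)) k<2 = contradiction (s≤s (s≤s z≤n)) k<2
  bonus≡0 : ∀ k → ¬ 2 ≤ k → bonus k ≡ 0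
  bonus≡0 0 _ = refl
  bonus≡0 1 _ = refl
  bonus≡0 (suc (suc k)) k<2 = contradiction (s≤s (s≤s z≤n)) k<2
  wF-N : ∀ X → wF (N X A⁺) ≡ wF (N X A)
  wF-N X = total-N-big w X A λ {s} → w≡0 ∣ s ∣
  count2-N : ∀ X → count2 (N X A⁺) ≡ count2 (N X A)
  count2-N X = trans (count2-total (N X A⁺))
    (trans (total-N-big (bonus ∘ ∣_∣) X A λ {s} → bonus≡0 ∣ s ∣) (sym (count2-total (N X A))))
  no-improvement′ : ∀ X → length X ≤ 10 → ¬ LocalImprovement 𝒮 A⁺ X
  no-improvement′ X ∣X∣≤10 (X-feasible , better) = no-improvement X ∣X∣≤10
    (X-feasible , subst₂ (λ k m → wF X > k ⊎ (wF X ≡ k × count2 X > m)) (wF-N X) (count2-N X) better)
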